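{- Let $(R_1,\mathcal L_1)$ and $(R_2,\mathcal L_2)$ be sets with a language. Equip $R_1^k$ and $R_2^{k'}$ with $\mathcal L_1^{(k)}$ respectively $\mathcal L_2^{(k')}$. Let $d_1:R_1\to R_2$ and $d_2:R_1^k\to R_2^{k'}$ be maps. If $d_1$ is an injective Diophantine map and $d_2$ is given by a Diophantine expression in $d_1$, then $d_2$ is a Diophantine map.
   Context: A "set with a language" $(R,\mathcal L)$ is a set $R$ together with a language $\mathcal L$ (constants, functions, relations) with an interpretation in $R$; every language contains a constant $0$ and equality. Terms are built from constants and variables using functions of $\mathcal L$; basic formulas have the form $(t_1,\ldots,t_m)\in R'$ with $R'\in\mathcal L$ an $m$-ary relation (possibly equality) and $t_i$ terms. $S\subset R^m$ is Diophantine if $S=\{\vec x\in R^m\mid\exists\vec y\in R^l\ (f_1\wedge\cdots\wedge f_r)\}$ for some basic formulas $f_i$. A map $d:A\to B$ between sets with a language is a Diophantine map if the coordinatewise image $d(S)\subset B^m$ is Diophantine for all $m$ and all Diophantine $S\subset A^m$. The language $\mathcal L^{(k)}$ on $R^k$: each constant $c\in\mathcal L$ gives the constant $(c,0,\ldots,0)$; each $r$-ary function $f\in\mathcal L$ gives the $r$-ary function $(\vec x_1,\ldots,\vec x_r)\mapsto(f(x_{11},\ldots,x_{r1}),0,\ldots,0)$; each $r$-ary relation $S\in\mathcal L$ gives the $r$-ary relation $\{((x_1,\vec 0),\ldots,(x_r,\vec 0))\mid(x_1,\ldots,x_r)\in S\}$; and for $1\le i\le k$ there is the unary function $\pi_i(\vec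 x)=(x_i,0,\ldots,0)$; equality on $R^k$ is also available. $d_2:R_1^k\to R_2^{k'}$ is given by a Diophantine expression in $d_1:R_1\to R_2$ if there exist basic $\mathcal L_2$-formulas $f_1,\ldots,f_n$ and an $l'$ such that for all $\vec x\in R_1^k$, $\vec z\in R_2^{k'}$: $d_2(\vec x)=\vec z\iff\exists\vec y\in R_2^{l'},\ \forall1\le i\le n,\ f_i(d_1(\vec x),\vec y,\vec z)$, where $d_1(\vec x)=(d_1(x_1),\ldots,d_1(x_k))$. -}

module Defs where

open import Data.Fin.Base using (Fin)
open import Data.List.Base using (List)
open import Data.List.Relation.Unary.All using (All)
open import Data.Nat.Base using (ℕ; suc; _+_)
open import Data.Product.Base using (∃; _×_)
open import Data.Vec.Base using (Vec; []; _∷_; _++_; head; lookup; map; replicate)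
open import Function.Bundles using (_⇔_; mk⇔)
import Level
open import Level using (Level)
open import Relation.Binary.PropositionalEquality using (_≡_)
open import Relation.Unary using (Pred; _∈_; _≐_)

private
  variable
    ℓ : Level
    m n k k′ r : ℕ

-- Func and Rel are indexed by arity.
record Language (ℓ : Level) : Set (Level.suc ℓ) where
  field
    Const : Set ℓ
    Func  : ℕ → Set ℓ
    Rel   : ℕ → Set ℓ
    zeroC : Const
    eqR   : Rel 2

record Interpretation (L : Language ℓ) (R : Set ℓ) : Set (Level.suc ℓ) where
  open Language L
  field
    ⟦_⟧ᶜ : Const → R
    ⟦_⟧ᶠ : Func r → Vec R r → R
    ⟦_⟧ᴿ : Rel r → Pred (Vec R r) ℓ
    -- The symbol eqR denotes actual equality on R.
    eqR-correct : ∀ x y → (x ∷ y ∷ []) ∈ ⟦ eqR ⟧ᴿ ⇔ x ≡ y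

data Term (L : Language ℓ) (n : ℕ) : Set ℓ where
  var : Fin n → Term L n
  con : Language.Const L → Term L n
  app : Language.Func L r → Vec (Term L n) r → Term L n

data BasicFormula (L : Language ℓ) (n : ℕ) : Set ℓ where
  atom : Language.Rel L r → Vec (Term L n) r → BasicFormula L n

module Semantics {L : Language ℓ} {R : Set ℓ} (I : Interpretation L R) where
  open Interpretation I

  mutual
    eval : Vec R n → Term L n → R
    eval ρ (var i)    = lookup ρ i
    eval ρ (con c)    = ⟦ c ⟧ᶜ
    eval ρ (app f ts) = ⟦ f ⟧ᶠ (evals ρ ts)

    evals : Vec R n → Vec (Term L n) r → Vec R r
    evals ρ []       = []
    evals ρ (t ∷ ts) = eval ρ t ∷ evals ρ ts

  infix 4 _⊨_
  _⊨_ : Vec R n → BasicFormula L n → Set ℓ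
  ρ ⊨ atom P ts = evals ρ ts ∈ ⟦ P ⟧ᴿ

  -- A list of formulas is read as their conjunction.
  Diophantine : Pred (Vec R m) ℓ → Set ℓ
  Diophantine {m = m} S =
    ∃ λ (l : ℕ) → ∃ λ (fs : List (BasicFormula L (m + l))) →
      S ≐ (λ x → ∃ λ (y : Vec R l) → All (λ f → (x ++ y) ⊨ f) fs)

open Semantics public using (Diophantine)

image : {A B : Set ℓ} → (A → B) → Pred (Vec A m) ℓ → Pred (Vec B m) ℓ
image d S y = ∃ λ x → x ∈ S × map d x ≡ y

DiophantineMap : {L₁ L₂ : Language ℓ} {A B : Set ℓ} →
                 Interpretation L₁ A → Interpretation L₂ B →
                 (A → B) → Set (Level.suc ℓ)
DiophantineMap {ℓ = ℓ} {A = A} I₁ I₂ d =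
  ∀ (m : ℕ) (S : Pred (Vec A m) ℓ) → Diophantine I₁ S → Diophantine I₂ (image d S)

data PowerFunc (L : Language ℓ) (k : ℕ) : ℕ → Set ℓ where
  lift : Language.Func L r → PowerFunc L k r
  π    : Fin k → PowerFunc L k 1

-- The equality symbol of L is lifted like every other relation, to
-- {((x,0,…,0),(x,0,…,0))}; equality on all of R^k is the extra symbol eq.
data PowerRel (L : Language ℓ) : ℕ → Set ℓ where
  lift : Language.Rel L r → PowerRel L r
  eq   : PowerRel L 2

PowerLanguage : Language ℓ → ℕ → Language ℓ
PowerLanguage L k = record
  { Const = Language.Const L
  ; Func  = PowerFunc L k
  ; Rel   = PowerRel L
  ; zeroC = Language.zeroC L
  ; eqR   = eq
  }

-- The exponent is written suc k because (x,0,…,0) requires a first coordinate.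
module Power {L : Language ℓ} {R : Set ℓ} (I : Interpretation L R) (k : ℕ) where
  open Interpretation I

  pad : R → Vec R (suc k)
  pad x = x ∷ replicate k ⟦ Language.zeroC L ⟧ᶜ

  powerFunc : PowerFunc L (suc k) r → Vec (Vec R (suc k)) r → Vec R (suc k)
  powerFunc (lift f) xs       = pad (⟦ f ⟧ᶠ (map head xs))
  powerFunc (π i)    (x ∷ []) = pad (lookup x i)

  powerRel : PowerRel L r → Pred (Vec (Vec R (suc k)) r) ℓ
  powerRel (lift P) xs           = ∃ λ as → as ∈ ⟦ P ⟧ᴿ × xs ≡ map pad as
  powerRel eq       (x ∷ y ∷ []) = x ≡ y

  power : Interpretation (PowerLanguage L (suc k)) (Vec R (suc k))
  power = record
    { ⟦_⟧ᶜ        = λ c → pad ⟦ c ⟧ᶜ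
    ; ⟦_⟧ᶠ        = powerFunc
    ; ⟦_⟧ᴿ        = powerRel
    ; eqR-correct = λ x y → mk⇔ (λ p → p) (λ p → p)
    }

open Power public using (power)

GivenByDiophantineExpression :
  {L₂ : Language ℓ} {R₁ R₂ : Set ℓ} → Interpretation L₂ R₂ →
  (R₁ → R₂) → (Vec R₁ k → Vec R₂ k′) → Set ℓ
GivenByDiophantineExpression {k = k} {k′ = k′} {L₂ = L₂} {R₁ = R₁} {R₂ = R₂} I₂ d₁ d₂ =
  ∃ λ (l′ : ℕ) → ∃ λ (fs : List (BasicFormula L₂ (k + (l′ + k′)))) →
    ∀ (x : Vec R₁ k) (z : Vec R₂ k′) →
      d₂ x ≡ z ⇔ ∃ λ (y : Vec R₂ l′) → All (λ f → (map d₁ x ++ (y ++ z)) ⊨ f) fs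
  where open Semantics I₂ using (_⊨_)

{-# OPTIONS --safe #-}
module Submission where

-- Write K = suc k and K′ = suc k′.  A subset S of (R₁^K)^m can be read as a
-- subset S♭ of R₁^(m * K) by listing coordinates.  The proof moves S down to
-- R₁, across to R₂ along d₁, and back up to R₂^K′:
--
--   * S♭ is Diophantine over L₁ (lower, flatten): every term of the power language has
--     K coordinates, each of which is a term of L₁, so an atom of the power
--     language amounts to finitely many atoms of L₁, and a variable ranging
--     over R₁^K to K variables ranging over R₁.
--   * D = image d₁ S♭ is Diophantine over L₂, since d₁ is a Diophantine map.
--   * The set T of v ∈ R₂^(m * K′), with blocks v_j, for which there is a
--     w ∈ D whose blocks w_j satisfy ∃ y, fs (w_j , y , v_j) for every j < m,
--     is Diophantine by the closure of Diophantine sets under substitution,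
--     finite intersection and projection.  Here fs is the Diophantine
--     expression for d₂.  Since w = d₁ u with u ∈ S♭, the condition on the j-th
--     blocks says d₂ u_j = v_j, so T is the image of S under d₂, flattened.
--   * A Diophantine set over L₂ stays Diophantine when read in the power
--     language (raise, unflatten): the projections π supply the coordinates, and every
--     L₂-term t is represented by a term with value (t,0,…,0).

open import Defs
open import Data.Fin.Base using (Fin; zero; suc; _↑ˡ_; _↑ʳ_)
open import Data.List.Base as List using (List; []; _∷_)
open import Data.List.Relation.Unary.All as All using (All; []; _∷_)
import Data.List.Relation.Unary.All.Properties as All
open import Data.Nat.Base using (ℕ; zero; suc; _+_; _*_)
open import Data.Product.Base using (∃; _×_; _,_)
open import Data.Vec.Base
  using (Vec; []; _∷_; _++_; concat; drop; head; lookup; map; replicate; tabulate; take)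
open import Data.Vec.Properties
  using ( ++-injectiveˡ; ++-injectiveʳ; drop-map; lookup-++ˡ; lookup-++ʳ; lookup-map
        ; map-++; map-concat; map-cong; map-∘; tabulate-cong; tabulate-∘
        ; tabulate∘lookup; take-map; take++drop≡id; ∷-injective)
open import Function.Base using (_∘_)
open import Function.Bundles using (_⇔_; mk⇔; Equivalence)
open import Function.Definitions using (Injective)
open import Level using (Level)
open import Relation.Binary.PropositionalEquality
  using (_≡_; refl; sym; trans; cong; cong₂; subst; module ≡-Reasoning)
open import Relation.Unary using (Pred; _∈_; _≐_; _∩_)

open Equivalence using (to; from)
open ≡-Reasoning

private
  variable
    a p ℓ   : Level
    A B     : Set a
    m n N r : ℕ

-- Vectors

lookup-zero : (xs : Vec A (suc n)) → lookup xs zero ≡ head xs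
lookup-zero (x ∷ xs) = refl

lookup-ext : {xs ys : Vec A n} → (∀ i → lookup xs i ≡ lookup ys i) → xs ≡ ys
lookup-ext {xs = xs} {ys} xs≗ys = begin
  xs                    ≡⟨ tabulate∘lookup xs ⟨
  tabulate (lookup xs)  ≡⟨ tabulate-cong xs≗ys ⟩
  tabulate (lookup ys)  ≡⟨ tabulate∘lookup ys ⟩
  ys                    ∎

-- The n consecutive blocks of length r of a vector.
chunk : ∀ n r → Vec A (n * r) → Vec (Vec A r) n
chunk zero    r xs = []
chunk (suc n) r xs = take r xs ∷ chunk n r (drop r xs)

chunk-concat : (xss : Vec (Vec A r) n) → chunk n r (concat xss) ≡ xss
chunk-concat                     []         = refl
chunk-concat {r = r} {n = suc n} (xs ∷ xss) =
  cong₂ _∷_ (++-injectiveˡ _ xs split)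
            (trans (cong (chunk n r) (++-injectiveʳ _ xs split)) (chunk-concat xss))
  where
  split : take r (xs ++ concat xss) ++ drop r (xs ++ concat xss) ≡ xs ++ concat xss
  split = take++drop≡id r _

map-chunk : (f : A → B) (n r : ℕ) (xs : Vec A (n * r)) →
            map (map f) (chunk n r xs) ≡ chunk n r (map f xs)
map-chunk f zero    r xs = refl
map-chunk f (suc n) r xs =
  cong₂ _∷_ (sym (take-map f r xs))
            (trans (map-chunk f n r (drop r xs)) (cong (chunk n r) (sym (drop-map f r xs))))

All-map⇔ : {P : Pred A p} {Q : Pred B p} {g : A → B} →
           (∀ x → P x ⇔ Q (g x)) → (xs : List A) → All P xs ⇔ All Q (List.map g xs)
All-map⇔ eqv xs =
  mk⇔ (λ ps → All.map⁺ (All.map (to (eqv _)) ps))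
      (λ qs → All.map (from (eqv _)) (All.map⁻ qs))

-- Substitution

module _ {L : Language ℓ} where

  mutual
    substTerm : Vec (Term L N) n → Term L n → Term L N
    substTerm σ (var i)    = lookup σ i
    substTerm σ (con c)    = con c
    substTerm σ (app f ts) = app f (substTerms σ ts)

    substTerms : Vec (Term L N) n → Vec (Term L n) r → Vec (Term L N) r
    substTerms σ []       = []
    substTerms σ (t ∷ ts) = substTerm σ t ∷ substTerms σ ts

  substFormula : Vec (Term L N) n → BasicFormula L n → BasicFormula L N
  substFormula σ (atom P ts) = atom P (substTerms σ ts)

  -- The first m and the last n of m + n variables.
  varsˡ : ∀ m n → Vec (Term L (m + n)) m
  varsˡ m n = tabulate (λ i → var (i ↑ˡ n))

  varsʳ : ∀ m n → Vec (Term L (m + n)) n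
  varsʳ m n = tabulate (λ i → var (m ↑ʳ i))

  -- Terms in m variables, viewed as terms in the first m of m + n variables.
  weaken : ∀ n → Vec (Term L m) r → Vec (Term L (m + n)) r
  weaken {m = m} n = substTerms (varsˡ m n)

module Evaluation {L : Language ℓ} {R : Set ℓ} (I : Interpretation L R) where
  open Interpretation I
  open Semantics I hiding (Diophantine)

  evals≡map : (ρ : Vec R n) (ts : Vec (Term L n) r) → evals ρ ts ≡ map (eval ρ) ts
  evals≡map ρ []       = refl
  evals≡map ρ (t ∷ ts) = cong (eval ρ t ∷_) (evals≡map ρ ts)

  evals-++ : (ρ : Vec R n) (ts : Vec (Term L n) r) (us : Vec (Term L n) m) →
             evals ρ (ts ++ us) ≡ evals ρ ts ++ evals ρ us
  evals-++ ρ []       us = refl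
  evals-++ ρ (t ∷ ts) us = cong (eval ρ t ∷_) (evals-++ ρ ts us)

  eval-lookup : (ρ : Vec R n) (ts : Vec (Term L n) r) (i : Fin r) →
                eval ρ (lookup ts i) ≡ lookup (evals ρ ts) i
  eval-lookup ρ (t ∷ ts) zero    = refl
  eval-lookup ρ (t ∷ ts) (suc i) = eval-lookup ρ ts i

  map-evals-chunk : (u : Vec R N) (m q : ℕ) (ts : Vec (Term L N) (m * q)) →
                    map (evals u) (chunk m q ts) ≡ chunk m q (evals u ts)
  map-evals-chunk u m q ts = begin
    map (evals u) (chunk m q ts)       ≡⟨ map-cong (evals≡map u) _ ⟩
    map (map (eval u)) (chunk m q ts)  ≡⟨ map-chunk (eval u) m q ts ⟩
    chunk m q (map (eval u) ts)        ≡⟨ cong (chunk m q) (evals≡map u ts) ⟨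
    chunk m q (evals u ts)             ∎

  evals-tabulate-var : (ρ : Vec R n) (g : Fin r → Fin n) →
                       evals ρ (tabulate (var ∘ g)) ≡ tabulate (lookup ρ ∘ g)
  evals-tabulate-var ρ g = begin
    evals ρ (tabulate (var ∘ g))       ≡⟨ evals≡map ρ _ ⟩
    map (eval ρ) (tabulate (var ∘ g))  ≡⟨ tabulate-∘ (eval ρ) (var ∘ g) ⟨
    tabulate (lookup ρ ∘ g)            ∎

  evals-varsˡ : (xs : Vec R m) (ys : Vec R n) → evals (xs ++ ys) (varsˡ m n) ≡ xs
  evals-varsˡ xs ys =
    trans (evals-tabulate-var (xs ++ ys) _)
          (trans (tabulate-cong (lookup-++ˡ xs ys)) (tabulate∘lookup xs))

  evals-varsʳ : (xs : Vec R m) (ys : Vec R n) → evals (xs ++ ys) (varsʳ m n) ≡ ys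
  evals-varsʳ xs ys =
    trans (evals-tabulate-var (xs ++ ys) _)
          (trans (tabulate-cong (lookup-++ʳ xs ys)) (tabulate∘lookup ys))

  mutual
    eval-subst : (ρ : Vec R N) (σ : Vec (Term L N) n) (t : Term L n) →
                 eval ρ (substTerm σ t) ≡ eval (evals ρ σ) t
    eval-subst ρ σ (var i)    = eval-lookup ρ σ i
    eval-subst ρ σ (con c)    = refl
    eval-subst ρ σ (app f ts) = cong ⟦ f ⟧ᶠ (evals-subst ρ σ ts)

    evals-subst : (ρ : Vec R N) (σ : Vec (Term L N) n) (ts : Vec (Term L n) r) →
                  evals ρ (substTerms σ ts) ≡ evals (evals ρ σ) ts
    evals-subst ρ σ []       = refl
    evals-subst ρ σ (t ∷ ts) = cong₂ _∷_ (eval-subst ρ σ t) (evals-subst ρ σ ts)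

  evals-weaken : (xs : Vec R m) (ys : Vec R n) (ts : Vec (Term L m) r) →
                 evals (xs ++ ys) (weaken n ts) ≡ evals xs ts
  evals-weaken xs ys ts =
    trans (evals-subst (xs ++ ys) (varsˡ _ _) ts) (cong (λ ρ → evals ρ ts) (evals-varsˡ xs ys))

  evals-weakenʳ : (xs : Vec R m) (ys : Vec R n) (ts : Vec (Term L n) r) {v : Vec R r} →
                  evals ys ts ≡ v → evals (xs ++ ys) (substTerms (varsʳ m n) ts) ≡ v
  evals-weakenʳ xs ys ts e =
    trans (evals-subst (xs ++ ys) (varsʳ _ _) ts)
          (trans (cong (λ ρ → evals ρ ts) (evals-varsʳ xs ys)) e)

  ⊨-subst : (ρ : Vec R N) (σ : Vec (Term L N) n) (f : BasicFormula L n) →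
            (evals ρ σ ⊨ f) ≡ (ρ ⊨ substFormula σ f)
  ⊨-subst ρ σ (atom P ts) = cong ⟦ P ⟧ᴿ (sym (evals-subst ρ σ ts))

  All-⊨-subst : {ρ : Vec R N} (σ : Vec (Term L N) n) {ρ′ : Vec R n} → evals ρ σ ≡ ρ′ →
                (fs : List (BasicFormula L n)) →
                All (ρ′ ⊨_) fs ⇔ All (ρ ⊨_) (List.map (substFormula σ) fs)
  All-⊨-subst {ρ = ρ} σ refl =
    All-map⇔ (λ f → mk⇔ (subst (λ X → X) (⊨-subst ρ σ f))
                        (subst (λ X → X) (sym (⊨-subst ρ σ f))))

-- Closure properties of Diophantine sets

module Closure {L : Language ℓ} {R : Set ℓ} (I : Interpretation L R) where
  open Language L
  open Interpretation I
  open Semantics I hiding (Diophantine)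
  open Evaluation I

  Diophantine-resp-≐ : {S T : Pred (Vec R n) ℓ} → S ≐ T → Diophantine I S → Diophantine I T
  Diophantine-resp-≐ (S⊆T , T⊆S) (l , fs , S⊆ , ⊆S) =
    l , fs , (S⊆ ∘ T⊆S) , (S⊆T ∘ ⊆S)

  -- Parameters may be replaced by arbitrary terms s and t in a condition of the
  -- form ∃ y, fs (s , y , t).
  ∃-Diophantine : ∀ {l q} (fs : List (BasicFormula L (m + (l + q))))
                  (s : Vec (Term L N) m) (t : Vec (Term L N) q) →
                  Diophantine I (λ (ρ : Vec R N) → ∃ λ (y : Vec R l) →
                                   All (λ f → (evals ρ s ++ (y ++ evals ρ t)) ⊨ f) fs)
  ∃-Diophantine {N = N} {l = l} fs s t =
    l , List.map (substFormula σ) fs ,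
    (λ {ρ} (y , h) → y , to   (All-⊨-subst σ (evals-σ ρ y) fs) h) ,
    (λ {ρ} (y , h) → y , from (All-⊨-subst σ (evals-σ ρ y) fs) h)
    where
    σ : Vec (Term L (N + l)) _
    σ = weaken l s ++ (varsʳ N l ++ weaken l t)

    evals-σ : ∀ ρ y → evals (ρ ++ y) σ ≡ evals ρ s ++ (y ++ evals ρ t)
    evals-σ ρ y =
      trans (evals-++ (ρ ++ y) (weaken l s) _)
        (cong₂ _++_ (evals-weaken ρ y s)
          (trans (evals-++ (ρ ++ y) (varsʳ N l) _)
            (cong₂ _++_ (evals-varsʳ ρ y) (evals-weaken ρ y t))))

  substitution : {S : Pred (Vec R n) ℓ} (σ : Vec (Term L N) n) →
                 Diophantine I S → Diophantine I (λ ρ → evals ρ σ ∈ S)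
  substitution {N = N} σ (l , fs , S⊆ , ⊆S) =
    l , List.map (substFormula σ′) fs ,
    (λ {ρ} s → let y , h = S⊆ s in y , to (All-⊨-subst σ′ (evals-σ′ ρ y) fs) h) ,
    (λ {ρ} (y , h) → ⊆S (y , from (All-⊨-subst σ′ (evals-σ′ ρ y) fs) h))
    where
    σ′ : Vec (Term L (N + l)) _
    σ′ = weaken l σ ++ varsʳ N l

    evals-σ′ : ∀ ρ y → evals (ρ ++ y) σ′ ≡ evals ρ σ ++ y
    evals-σ′ ρ y =
      trans (evals-++ (ρ ++ y) (weaken l σ) (varsʳ N l))
        (cong₂ _++_ (evals-weaken ρ y σ) (evals-varsʳ ρ y))

  conjunction : (fs : List (BasicFormula L n)) → Diophantine I (λ ρ → All (ρ ⊨_) fs)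
  conjunction {n = n} fs =
    0 , List.map (substFormula (varsˡ n 0)) fs ,
    (λ {ρ} h → [] , to (All-⊨-subst (varsˡ n 0) (evals-varsˡ ρ []) fs) h) ,
    (λ { {ρ} ([] , h) → from (All-⊨-subst (varsˡ n 0) (evals-varsˡ ρ []) fs) h })

  atom-Diophantine : (P : Rel r) (ts : Vec (Term L n) r) →
                     Diophantine I (λ ρ → evals ρ ts ∈ ⟦ P ⟧ᴿ)
  atom-Diophantine P ts =
    Diophantine-resp-≐ (All.head , λ h → h ∷ []) (conjunction (atom P ts ∷ []))

  Diophantine-∩ : {S T : Pred (Vec R n) ℓ} →
                  Diophantine I S → Diophantine I T → Diophantine I (S ∩ T)
  Diophantine-∩ {n = n} (l₁ , fs , S⊆ , ⊆S) (l₂ , gs , T⊆ , ⊆T) =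
    l₁ + l₂ , List.map (substFormula σ) fs List.++ List.map (substFormula τ) gs ,
    (λ {ρ} (s , t) → let y , h = S⊆ s
                         z , k = T⊆ t
                     in y ++ z , All.++⁺ (to (All-⊨-subst σ (evals-σ ρ y z) fs) h)
                                         (to (All-⊨-subst τ (evals-τ ρ y z) gs) k)) ,
    (λ {ρ} (w , h) → split ρ (take l₁ w) (drop l₁ w)
                       (subst (λ v → All ((ρ ++ v) ⊨_) _) (sym (take++drop≡id l₁ w)) h))
    where
    σ : Vec (Term L (n + (l₁ + l₂))) (n + l₁)
    σ = varsˡ n (l₁ + l₂) ++ substTerms (varsʳ n (l₁ + l₂)) (varsˡ l₁ l₂)

    τ : Vec (Term L (n + (l₁ + l₂))) (n + l₂)
    τ = varsˡ n (l₁ + l₂) ++ substTerms (varsʳ n (l₁ + l₂)) (varsʳ l₁ l₂)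

    evals-σ : ∀ ρ y z → evals (ρ ++ (y ++ z)) σ ≡ ρ ++ y
    evals-σ ρ y z =
      trans (evals-++ _ (varsˡ n _) _)
        (cong₂ _++_ (evals-varsˡ ρ (y ++ z)) (evals-weakenʳ ρ (y ++ z) _ (evals-varsˡ y z)))

    evals-τ : ∀ ρ y z → evals (ρ ++ (y ++ z)) τ ≡ ρ ++ z
    evals-τ ρ y z =
      trans (evals-++ _ (varsˡ n _) _)
        (cong₂ _++_ (evals-varsˡ ρ (y ++ z)) (evals-weakenʳ ρ (y ++ z) _ (evals-varsʳ y z)))

    split : ∀ ρ y z →
            All ((ρ ++ (y ++ z)) ⊨_)
                (List.map (substFormula σ) fs List.++ List.map (substFormula τ) gs) →
            _
    split ρ y z h =
      ⊆S (y , from (All-⊨-subst σ (evals-σ ρ y z) fs) (All.++⁻ˡ _ h)) ,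
      ⊆T (z , from (All-⊨-subst τ (evals-τ ρ y z) gs) (All.++⁻ʳ _ h))

  Diophantine-⋂-Fin : ∀ {q} {S : Fin q → Pred (Vec R n) ℓ} →
                      (∀ i → Diophantine I (S i)) → Diophantine I (λ ρ → ∀ i → ρ ∈ S i)
  Diophantine-⋂-Fin {q = zero}  ds =
    Diophantine-resp-≐ ((λ _ ()) , λ _ → []) (conjunction [])
  Diophantine-⋂-Fin {q = suc q} ds =
    Diophantine-resp-≐
      ((λ { (s , ss) zero → s ; (s , ss) (suc i) → ss i }) , (λ ss → ss zero , ss ∘ suc))
      (Diophantine-∩ (ds zero) (Diophantine-⋂-Fin (ds ∘ suc)))

  Diophantine-⋂-All : {A : Set ℓ} {S : A → Pred (Vec R n) ℓ} →
                      (∀ x → Diophantine I (S x)) → (xs : List A) →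
                      Diophantine I (λ ρ → All (λ x → ρ ∈ S x) xs)
  Diophantine-⋂-All ds []       = Diophantine-resp-≐ ((λ _ → []) , λ _ → []) (conjunction [])
  Diophantine-⋂-All ds (x ∷ xs) =
    Diophantine-resp-≐ ((λ (s , ss) → s ∷ ss) , (λ { (s ∷ ss) → s , ss }))
      (Diophantine-∩ (ds x) (Diophantine-⋂-All ds xs))

  projection : ∀ {q} {S : Pred (Vec R (n + q)) ℓ} → Diophantine I S →
               Diophantine I (λ ρ → ∃ λ (y : Vec R q) → (ρ ++ y) ∈ S)
  projection {n = n} {q} (l , fs , S⊆ , ⊆S) =
    q + l , List.map (substFormula σ) fs ,
    (λ {ρ} (y , s) → let z , h = S⊆ s
                     in y ++ z , to (All-⊨-subst σ (evals-σ ρ y z) fs) h) ,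
    (λ {ρ} (w , h) → take q w , ⊆S (drop q w ,
       from (All-⊨-subst σ (evals-σ ρ (take q w) (drop q w)) fs)
            (subst (λ v → All ((ρ ++ v) ⊨_) _) (sym (take++drop≡id q w)) h)))
    where
    σ : Vec (Term L (n + (q + l))) ((n + q) + l)
    σ = (varsˡ n (q + l) ++ substTerms (varsʳ n (q + l)) (varsˡ q l))
        ++ substTerms (varsʳ n (q + l)) (varsʳ q l)

    evals-σ : ∀ ρ y z → evals (ρ ++ (y ++ z)) σ ≡ (ρ ++ y) ++ z
    evals-σ ρ y z =
      trans (evals-++ _ (varsˡ n _ ++ substTerms (varsʳ n _) (varsˡ q l)) _)
        (cong₂ _++_
          (trans (evals-++ _ (varsˡ n _) _)
            (cong₂ _++_ (evals-varsˡ ρ (y ++ z)) (evals-weakenʳ ρ (y ++ z) _ (evals-varsˡ y z))))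
          (evals-weakenʳ ρ (y ++ z) _ (evals-varsʳ y z)))

  equation : (s t : Term L n) → Diophantine I (λ ρ → eval ρ s ≡ eval ρ t)
  equation s t =
    Diophantine-resp-≐ (to (eqR-correct _ _) , from (eqR-correct _ _))
      (atom-Diophantine eqR (s ∷ t ∷ []))

  equations : (ss ts : Vec (Term L n) r) → Diophantine I (λ ρ → evals ρ ss ≡ evals ρ ts)
  equations []       []       =
    Diophantine-resp-≐ ((λ _ → refl) , λ _ → []) (conjunction [])
  equations (s ∷ ss) (t ∷ ts) =
    Diophantine-resp-≐ ((λ (e , es) → cong₂ _∷_ e es) , ∷-injective)
      (Diophantine-∩ (equation s t) (equations ss ts))

  blockEquations : ∀ {q} (ss ts : Vec (Vec (Term L n) q) r) →
                   Diophantine I (λ ρ → map (evals ρ) ss ≡ map (evals ρ) ts)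
  blockEquations []       []       =
    Diophantine-resp-≐ ((λ _ → refl) , λ _ → []) (conjunction [])
  blockEquations (s ∷ ss) (t ∷ ts) =
    Diophantine-resp-≐ ((λ (e , es) → cong₂ _∷_ e es) , ∷-injective)
      (Diophantine-∩ (equations s t) (blockEquations ss ts))

-- Passing between a language and its power language

module PowerTransfer {L : Language ℓ} {R : Set ℓ} (I : Interpretation L R) (k : ℕ) where
  open Language L using (zeroC)
  open Interpretation I
  open Semantics I hiding (Diophantine)
  open Evaluation I
  open Closure I
  open Power I k using (pad)

  PL : Language ℓ
  PL = PowerLanguage L (suc k)

  private
    module P  = Semantics (power I k)
    module PE = Evaluation (power I k)

  map-head-pad : (xs : Vec R r) → map head (map pad xs) ≡ xs
  map-head-pad []       = refl
  map-head-pad (x ∷ xs) = cong (x ∷_) (map-head-pad xs)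

  -- A term of the power language is represented by the vector of its
  -- coordinates; this is the vector for pad.
  padTerm : Term L N → Vec (Term L N) (suc k)
  padTerm t = t ∷ replicate k (con zeroC)

  evals-padTerm : (u : Vec R N) (t : Term L N) → evals u (padTerm t) ≡ pad (eval u t)
  evals-padTerm u t = cong (eval u t ∷_) (zeros k)
    where
    zeros : ∀ k → evals u (replicate k (con zeroC)) ≡ replicate k ⟦ zeroC ⟧ᶜ
    zeros zero    = refl
    zeros (suc k) = cong (_ ∷_) (zeros k)

  map-head-evals : (u : Vec R N) (tss : Vec (Vec (Term L N) (suc k)) r) →
                   evals u (map head tss) ≡ map head (map (evals u) tss)
  map-head-evals u []               = refl
  map-head-evals u ((t ∷ ts) ∷ tss) = cong (eval u t ∷_) (map-head-evals u tss)

  -- The coordinates of a term of the power language, as L-terms, once the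
  -- coordinates τ of its variables are given as L-terms.
  mutual
    coordinates : Vec (Vec (Term L N) (suc k)) n → Term PL n → Vec (Term L N) (suc k)
    coordinates τ (var i)               = lookup τ i
    coordinates τ (con c)               = padTerm (con c)
    coordinates τ (app (lift f) ts)     = padTerm (app f (map head (coordinatess τ ts)))
    coordinates τ (app (π i) (t ∷ [])) = padTerm (lookup (coordinates τ t) i)

    coordinatess : Vec (Vec (Term L N) (suc k)) n → Vec (Term PL n) r →
                   Vec (Vec (Term L N) (suc k)) r
    coordinatess τ []       = []
    coordinatess τ (t ∷ ts) = coordinates τ t ∷ coordinatess τ ts

  mutual
    evals-coordinates : (u : Vec R N) (τ : Vec (Vec (Term L N) (suc k)) n) (t : Term PL n) →
                        evals u (coordinates τ t) ≡ P.eval (map (evals u) τ) t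
    evals-coordinates u τ (var i) = sym (lookup-map i (evals u) τ)
    evals-coordinates u τ (con c) = evals-padTerm u (con c)
    evals-coordinates u τ (app (lift f) ts) =
      trans (evals-padTerm u (app f (map head (coordinatess τ ts))))
        (cong (λ xs → pad (⟦ f ⟧ᶠ xs))
          (trans (map-head-evals u (coordinatess τ ts))
                 (cong (map head) (evals-coordinatess u τ ts))))
    evals-coordinates u τ (app (π i) (t ∷ [])) =
      trans (evals-padTerm u (lookup (coordinates τ t) i))
        (cong pad (trans (eval-lookup u (coordinates τ t) i)
                         (cong (λ x → lookup x i) (evals-coordinates u τ t))))

    evals-coordinatess : (u : Vec R N) (τ : Vec (Vec (Term L N) (suc k)) n)
                         (ts : Vec (Term PL n) r) →
                         map (evals u) (coordinatess τ ts) ≡ P.evals (map (evals u) τ) ts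
    evals-coordinatess u τ []       = refl
    evals-coordinatess u τ (t ∷ ts) =
      cong₂ _∷_ (evals-coordinates u τ t) (evals-coordinatess u τ ts)

  lowerFormula : (τ : Vec (Vec (Term L N) (suc k)) n) (f : BasicFormula PL n) →
                 Diophantine I (λ u → map (evals u) τ P.⊨ f)
  lowerFormula τ (atom eq (s ∷ t ∷ [])) =
    Diophantine-resp-≐
      ( (λ {u} e → trans (sym (evals-coordinates u τ s)) (trans e (evals-coordinates u τ t)))
      , (λ {u} e → trans (evals-coordinates u τ s) (trans e (sym (evals-coordinates u τ t)))))
      (equations (coordinates τ s) (coordinates τ t))
  -- A lifted relation holds when the first coordinates satisfy the original
  -- relation and the remaining coordinates vanish.
  lowerFormula {N = N} τ (atom (lift P) ts) =
    Diophantine-resp-≐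
      ( (λ {u} (h , e) → _ , h ,
           trans (sym (evals-coordinatess u τ ts)) (trans e (padded u)))
      , (λ {u} (as , h , e) →
           let heads : evals u (map head css) ≡ as
               heads = trans (map-head-evals u css)
                         (trans (cong (map head) (trans (evals-coordinatess u τ ts) e))
                                (map-head-pad as))
           in subst ⟦ P ⟧ᴿ (sym heads) h ,
              trans (evals-coordinatess u τ ts)
                (trans e (trans (cong (map pad) (sym heads)) (sym (padded u))))))
      (Diophantine-∩ (atom-Diophantine P (map head css))
                     (blockEquations css (map padTerm (map head css))))
    where
    css : Vec (Vec (Term L N) (suc k)) _
    css = coordinatess τ ts

    padded : ∀ u → map (evals u) (map padTerm (map head css))
                 ≡ map pad (evals u (map head css))
    padded u = begin
      map (evals u) (map padTerm (map head css))  ≡⟨ map-∘ (evals u) padTerm _ ⟨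
      map (evals u ∘ padTerm) (map head css)      ≡⟨ map-cong (evals-padTerm u) _ ⟩
      map (pad ∘ eval u) (map head css)           ≡⟨ map-∘ pad (eval u) _ ⟩
      map pad (map (eval u) (map head css))       ≡⟨ cong (map pad) (evals≡map u _) ⟨
      map pad (evals u (map head css))            ∎

  -- Each existential variable over R^(suc k) becomes a block of suc k
  -- existential variables over R.
  lower : {S : Pred (Vec (Vec R (suc k)) n) ℓ} (τ : Vec (Vec (Term L N) (suc k)) n) →
          Diophantine (power I k) S → Diophantine I (λ u → map (evals u) τ ∈ S)
  lower {n = n} {N = N} τ (l , fs , S⊆ , ⊆S) =
    Diophantine-resp-≐
      ( (λ {u} (v , h) → ⊆S (chunk l (suc k) v ,
           subst (λ ρ → All (ρ P.⊨_) fs) (evals-τ′ u v) h))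
      , (λ {u} s → let y , h = S⊆ s in concat y ,
           subst (λ ρ → All (ρ P.⊨_) fs)
             (sym (trans (evals-τ′ u (concat y)) (cong (map (evals u) τ ++_) (chunk-concat y)))) h))
      (projection (Diophantine-⋂-All (lowerFormula τ′) fs))
    where
    τ′ : Vec (Vec (Term L (N + l * suc k)) (suc k)) (n + l)
    τ′ = map (weaken (l * suc k)) τ ++ chunk l (suc k) (varsʳ N (l * suc k))

    evals-τ′ : ∀ u v → map (evals (u ++ v)) τ′ ≡ map (evals u) τ ++ chunk l (suc k) v
    evals-τ′ u v =
      trans (map-++ (evals (u ++ v)) (map (weaken _) τ) _)
        (cong₂ _++_
          (trans (sym (map-∘ (evals (u ++ v)) (weaken _) τ)) (map-cong (evals-weaken u v) τ))
          (trans (map-evals-chunk (u ++ v) l (suc k) (varsʳ N _))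
                 (cong (chunk l (suc k)) (evals-varsʳ u v))))

  -- The term of the power language with value (t,0,…,0), where the first
  -- coordinates of the terms σ are substituted for the variables of t.
  mutual
    raiseTerm : Vec (Term PL n) N → Term L N → Term PL n
    raiseTerm σ (var i)    = app (π zero) (lookup σ i ∷ [])
    raiseTerm σ (con c)    = con c
    raiseTerm σ (app f ts) = app (lift f) (raiseTerms σ ts)

    raiseTerms : Vec (Term PL n) N → Vec (Term L N) r → Vec (Term PL n) r
    raiseTerms σ []       = []
    raiseTerms σ (t ∷ ts) = raiseTerm σ t ∷ raiseTerms σ ts

  raiseFormula : Vec (Term PL n) N → BasicFormula L N → BasicFormula PL n
  raiseFormula σ (atom P ts) = atom (lift P) (raiseTerms σ ts)

  mutual
    eval-raise : (z : Vec (Vec R (suc k)) n) (σ : Vec (Term PL n) N) (t : Term L N) →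
                 P.eval z (raiseTerm σ t) ≡ pad (eval (map head (P.evals z σ)) t)
    eval-raise z σ (var i) = cong pad (begin
      lookup (P.eval z (lookup σ i)) zero   ≡⟨ lookup-zero (P.eval z (lookup σ i)) ⟩
      head (P.eval z (lookup σ i))          ≡⟨ cong head (PE.eval-lookup z σ i) ⟩
      head (lookup (P.evals z σ) i)         ≡⟨ lookup-map i head (P.evals z σ) ⟨
      lookup (map head (P.evals z σ)) i     ∎)
    eval-raise z σ (con c) = refl
    eval-raise z σ (app f ts) =
      cong (λ xs → pad (⟦ f ⟧ᶠ xs))
        (trans (cong (map head) (evals-raise z σ ts)) (map-head-pad _))

    evals-raise : (z : Vec (Vec R (suc k)) n) (σ : Vec (Term PL n) N) (ts : Vec (Term L N) r) →
                  P.evals z (raiseTerms σ ts) ≡ map pad (evals (map head (P.evals z σ)) ts)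
    evals-raise z σ []       = refl
    evals-raise z σ (t ∷ ts) = cong₂ _∷_ (eval-raise z σ t) (evals-raise z σ ts)

  ⊨-raise : (z : Vec (Vec R (suc k)) n) (σ : Vec (Term PL n) N) {ρ : Vec R N} →
            map head (P.evals z σ) ≡ ρ →
            (f : BasicFormula L N) → ρ ⊨ f ⇔ z P.⊨ raiseFormula σ f
  ⊨-raise z σ refl (atom P ts) =
    mk⇔ (λ h → _ , h , evals-raise z σ ts)
        (λ (as , h , e) →
           subst ⟦ P ⟧ᴿ
             (trans (sym (map-head-pad as))
               (trans (cong (map head) (trans (sym e) (evals-raise z σ ts))) (map-head-pad _)))
             h)

  -- An existential variable over R is replaced by the first coordinate of an
  -- existential variable over R^(suc k).
  raise : {T : Pred (Vec R N) ℓ} (σ : Vec (Term PL n) N) →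
          Diophantine I T → Diophantine (power I k) (λ z → map head (P.evals z σ) ∈ T)
  raise {N = N} {n = n} σ (l , fs , T⊆ , ⊆T) =
    l , List.map (raiseFormula σ′) fs ,
    (λ {z} t → let y , h = T⊆ t in map pad y ,
       to (All-map⇔ (⊨-raise _ σ′
             (trans (heads z (map pad y))
                    (cong (map head (P.evals z σ) ++_) (map-head-pad y)))) fs) h) ,
    (λ {z} (y , h) → ⊆T (map head y , from (All-map⇔ (⊨-raise _ σ′ (heads z y)) fs) h))
    where
    σ′ : Vec (Term PL (n + l)) (N + l)
    σ′ = weaken l σ ++ varsʳ n l

    heads : ∀ z y → map head (P.evals (z ++ y) σ′) ≡ map head (P.evals z σ) ++ map head y
    heads z y =
      trans (cong (map head) (trans (PE.evals-++ (z ++ y) (weaken l σ) (varsʳ n l))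
                                    (cong₂ _++_ (PE.evals-weaken z y σ) (PE.evals-varsʳ z y))))
            (map-++ head (P.evals z σ) y)

  -- Terms whose values are (x,0,…,0), for x ranging over all coordinates of
  -- all variables.
  allCoordinates : ∀ m → Vec (Term PL m) (m * suc k)
  allCoordinates m = concat (tabulate λ j → tabulate λ i → app (π i) (var j ∷ []))

  heads-allCoordinates : (z : Vec (Vec R (suc k)) m) →
                         map head (P.evals z (allCoordinates m)) ≡ concat z
  heads-allCoordinates {m = m} z = begin
    map head (P.evals z (allCoordinates m))
      ≡⟨ cong (map head) (PE.evals≡map z (allCoordinates m)) ⟩
    map head (map (P.eval z) (allCoordinates m))
      ≡⟨ map-∘ head (P.eval z) (allCoordinates m) ⟨
    map g (concat (tabulate blocks))
      ≡⟨ map-concat g (tabulate blocks) ⟩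
    concat (map (map g) (tabulate blocks))
      ≡⟨ cong concat (tabulate-∘ (map g) blocks) ⟨
    concat (tabulate (map g ∘ blocks))
      ≡⟨ cong concat (tabulate-cong λ j → sym (tabulate-∘ g λ i → app (π i) (var j ∷ []))) ⟩
    concat (tabulate λ j → tabulate (lookup (lookup z j)))
      ≡⟨ cong concat (tabulate-cong λ j → tabulate∘lookup (lookup z j)) ⟩
    concat (tabulate (lookup z))
      ≡⟨ cong concat (tabulate∘lookup z) ⟩
    concat z ∎
    where
    g : Term PL m → R
    g t = head (P.eval z t)

    blocks : Fin m → Vec (Term PL m) (suc k)
    blocks j = tabulate λ i → app (π i) (var j ∷ [])

  flatten : {S : Pred (Vec (Vec R (suc k)) m) ℓ} → Diophantine (power I k) S →
            Diophantine I (λ u → chunk m (suc k) u ∈ S)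
  flatten {m = m} {S} dS =
    Diophantine-resp-≐
      ( (λ {u} → subst S (blocks u)) , (λ {u} → subst S (sym (blocks u))))
      (lower (chunk m (suc k) vars) dS)
    where
    vars : Vec (Term L (m * suc k)) (m * suc k)
    vars = tabulate var

    blocks : ∀ u → map (evals u) (chunk m (suc k) vars) ≡ chunk m (suc k) u
    blocks u =
      trans (map-evals-chunk u m (suc k) vars)
        (cong (chunk m (suc k)) (trans (evals-tabulate-var u (λ i → i)) (tabulate∘lookup u)))

  unflatten : {T : Pred (Vec R (m * suc k)) ℓ} → Diophantine I T →
              Diophantine (power I k) (λ (z : Vec (Vec R (suc k)) m) → concat z ∈ T)
  unflatten {m = m} {T} dT =
    Closure.Diophantine-resp-≐ (power I k)
      ( (λ {z} → subst T (heads-allCoordinates z))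
      , (λ {z} → subst T (sym (heads-allCoordinates z))))
      (raise (allCoordinates m) dT)

-- Maps given by a Diophantine expression

proposition5p47 : ∀ {ℓ : Level} {L₁ L₂ : Language ℓ} {R₁ R₂ : Set ℓ}
    (I₁ : Interpretation L₁ R₁) (I₂ : Interpretation L₂ R₂) (k k′ : ℕ)
    (d₁ : R₁ → R₂) (d₂ : Vec R₁ (suc k) → Vec R₂ (suc k′)) →
    Injective _≡_ _≡_ d₁ →
    DiophantineMap I₁ I₂ d₁ →
    GivenByDiophantineExpression I₂ d₁ d₂ →
    DiophantineMap (power I₁ k) (power I₂ k′) d₂
proposition5p47 {ℓ} {L₁} {L₂} {R₁} {R₂} I₁ I₂ k k′ d₁ d₂ _ dio₁ (l′ , fs , expr) m S dS =
  Closure.Diophantine-resp-≐ (power I₂ k′) (T⊆image , image⊆T)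
    (PowerTransfer.unflatten I₂ k′ T-Diophantine)
  where
  open Semantics I₂ hiding (Diophantine)
  open Evaluation I₂
  open Closure I₂

  K K′ : ℕ
  K  = suc k
  K′ = suc k′

  S♭ : Pred (Vec R₁ (m * K)) ℓ
  S♭ u = chunk m K u ∈ S

  D : Pred (Vec R₂ (m * K)) ℓ
  D = image d₁ S♭

  D-Diophantine : Diophantine I₂ D
  D-Diophantine = dio₁ (m * K) S♭ (PowerTransfer.flatten I₁ k dS)

  -- The Diophantine expression for d₂, with d₁ x replaced by any w.
  E : Vec R₂ K → Vec R₂ K′ → Set ℓ
  E w z = ∃ λ (y : Vec R₂ l′) → All (λ f → (w ++ (y ++ z)) ⊨ f) fs

  T : Pred (Vec R₂ (m * K′)) ℓ
  T v = ∃ λ (w : Vec R₂ (m * K)) →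
          w ∈ D × (∀ j → E (lookup (chunk m K w) j) (lookup (chunk m K′ v) j))

  T-Diophantine : Diophantine I₂ T
  T-Diophantine =
    Diophantine-resp-≐
      ( (λ {v} (w , h , e) → w , subst D (evals-varsʳ v w) h ,
           λ j → subst₂E (ws v w j) (vs v w j) (e j))
      , (λ {v} (w , h , e) → w , subst D (sym (evals-varsʳ v w)) h ,
           λ j → subst₂E (sym (ws v w j)) (sym (vs v w j)) (e j)))
      (projection
        (Diophantine-∩ (substitution wVars D-Diophantine)
          (Diophantine-⋂-Fin λ j →
            ∃-Diophantine fs (lookup (chunk m K wVars) j)
                             (lookup (chunk m K′ vVars) j))))
    where
    vVars : Vec (Term L₂ (m * K′ + m * K)) (m * K′)
    vVars = varsˡ (m * K′) (m * K)

    wVars : Vec (Term L₂ (m * K′ + m * K)) (m * K)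
    wVars = varsʳ (m * K′) (m * K)

    subst₂E : ∀ {w w′ z z′} → w ≡ w′ → z ≡ z′ → E w z → E w′ z′
    subst₂E refl refl e = e

    evals-block : ∀ {n} (ρ : Vec R₂ n) q (ts : Vec (Term L₂ n) (m * q)) {v} →
                  evals ρ ts ≡ v → ∀ j →
                  evals ρ (lookup (chunk m q ts) j) ≡ lookup (chunk m q v) j
    evals-block ρ q ts refl j =
      trans (sym (lookup-map j (evals ρ) (chunk m q ts)))
            (cong (λ xs → lookup xs j) (map-evals-chunk ρ m q ts))

    ws : ∀ v w j → evals (v ++ w) (lookup (chunk m K wVars) j) ≡ lookup (chunk m K w) j
    ws v w = evals-block (v ++ w) K wVars (evals-varsʳ v w)

    vs : ∀ v w j → evals (v ++ w) (lookup (chunk m K′ vVars) j) ≡ lookup (chunk m K′ v) j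
    vs v w = evals-block (v ++ w) K′ vVars (evals-varsˡ v w)

  lookup-chunk-map : ∀ u j → lookup (chunk m K (map d₁ u)) j ≡ map d₁ (lookup (chunk m K u) j)
  lookup-chunk-map u j =
    trans (cong (λ xs → lookup xs j) (sym (map-chunk d₁ m K u)))
          (lookup-map j (map d₁) (chunk m K u))

  T⊆image : ∀ {z} → concat z ∈ T → z ∈ image d₂ S
  T⊆image {z} (_ , (u , s , refl) , e) = chunk m K u , s , lookup-ext λ j → begin
    lookup (map d₂ (chunk m K u)) j    ≡⟨ lookup-map j d₂ (chunk m K u) ⟩
    d₂ (lookup (chunk m K u) j)        ≡⟨ from (expr _ _) (E-block j) ⟩
    lookup (chunk m K′ (concat z)) j   ≡⟨ cong (λ xs → lookup xs j) (chunk-concat z) ⟩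
    lookup z j                         ∎
    where
    E-block : ∀ j → E (map d₁ (lookup (chunk m K u) j)) (lookup (chunk m K′ (concat z)) j)
    E-block j = subst (λ w → E w _) (lookup-chunk-map u j) (e j)

  image⊆T : ∀ {z} → z ∈ image d₂ S → concat z ∈ T
  image⊆T (x , s , refl) =
    map d₁ u , (u , subst S (sym (chunk-concat x)) s , refl) , λ j →
      subst (λ w → E w (lookup (chunk m K′ (concat (map d₂ x))) j)) (sym (lookup-chunk-map u j))
        (to (expr _ _) (begin
        d₂ (lookup (chunk m K u) j)                ≡⟨ cong (λ xs → d₂ (lookup xs j)) (chunk-concat x) ⟩
        d₂ (lookup x j)                            ≡⟨ lookup-map j d₂ x ⟨
        lookup (map d₂ x) j                        ≡⟨ cong (λ xs → lookup xs j) (chunk-concat (map d₂ x)) ⟨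
        lookup (chunk m K′ (concat (map d₂ x))) j  ∎))
    where
    u : Vec R₁ (m * K)
    u = concat x
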